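{- If $\mathbf w$ and $\mathbf u$ are reduced words of $w$ connected by braid moves, then for any $v\le w$ and any $r$, there is a bijection $\mathcal{A}^r_{v,\mathbf w}\to\mathcal{A}^r_{v,\mathbf u}$.
   Context: $v,w$ are elements of the affine Weyl group of type $\tilde A_{n-1}$, realized as the group of bijections $f:\mathbb{Z}\to\mathbb{Z}$ with $f(i+n)=f(i)+n$ and $\sum_{i=1}^n(f(i)-i)=0$, with simple generators $s_0,\dots,s_{n-1}$ ($s_i$ exchanges $i+mn$ and $i+1+mn$ for all $m$); $\le$ is Bruhat order and $\ell$ is length. A reduced word of $w$ is a sequence $\mathbf w=(s_{i_1},\dots,s_{i_m})$ with $w=s_{i_1}\cdots s_{i_m}$, $m=\ell(w)$. A braid move replaces consecutive letters $s_{i+1},s_i,s_{i+1}$ by $s_i,s_{i+1},s_i$ or vice versa (indices modulo $n$, $n\ge3$). A subword of $\mathbf w$ is $\mathbf v=(v_1,\dots,v_m)$ with $v_j\in\{s_{i_j},e\}$; it is a $v$-subword if $v_1\cdots v_m=v$; it is distinguished if $\mathbf v_{(j)}\le\mathbf v_{(j-1)}s_{i_j}$ for all $j$, where $\mathbf v_{(j)}=v_1\cdots v_j$. $\mathcal{A}^r_{v,\mathbf w}$ is the set of distinguished $v$-subwords of $\mathbf w$ with exactly $r$ entries equal to $e$. -}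

module Defs where

open import Algebra.Bundles using (Group)
open import Data.Fin.Base using (Fin; toℕ; fromℕ<)
open import Data.Fin.Permutation using (Permutation′; permutation; _⟨$⟩ʳ_)
open import Data.Fin.Properties using (toℕ-fromℕ<; toℕ-injective; toℕ<n)
open import Data.Fin.Subset using (Subset; Side; inside; outside; ∁; ∣_∣)
open import Data.Integer.Base
  using (ℤ; +_; -[1+_]; 0ℤ; 1ℤ; _+_; _-_; _*_; -_; _%ℕ_; _/ℕ_)
  renaming (∣_∣ to abs)
open import Data.Integer.Divisibility.Signed
  using (_∣_; divides; _∣?_; ∣m∣n⇒∣m+n; ∣m∣n⇒∣m-n; ∣m⇒∣-m; ∣-refl; ∣⇒∣ᵤ)
open import Data.Integer.DivMod using (a≡a%ℕn+[a/ℕn]*n; n%ℕd<d)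
open import Data.Integer.Properties
  using (+-identityʳ; +-injective; +-0-commutativeMonoid; m-n≡m⊖n;
         ∣m⊝n∣≤m⊔n; +-inverseʳ; i-j≡0⇒i≡j; ∣i∣≡0⇒i≡0)
open import Data.Integer.Tactic.RingSolver using (solve-∀)
open import Data.List.Base using (List; []; _∷_; _++_; foldr; map; length)
open import Data.Nat.Base as ℕ using (ℕ; zero; suc; NonZero; >-nonZero; s≤s; z≤n)
import Data.Nat.Divisibility as ℕ
import Data.Nat.Properties as ℕ
open import Data.Nat.DivMod using (_mod_)
open import Data.Product.Base using (∃-syntax; ∃₂; Σ-syntax; _×_; _,_; proj₁)
open import Data.Unit.Base using (⊤)
open import Data.Vec.Base using ([]; _∷_)
open import Function.Base using (_∘_)
open import Function.Bundles using (_↔_; Inverse; mk↔ₛ′)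
open import Function.Construct.Composition using (_↔-∘_)
open import Function.Construct.Identity using (↔-id)
open import Function.Construct.Symmetry using (↔-sym)
open import Level using (Level; 0ℓ; _⊔_)
open import Relation.Binary.Bundles using (Setoid)
open import Relation.Binary.Construct.Closure.Equivalence using (EqClosure)
import Relation.Binary.Construct.On as On
open import Relation.Binary.PropositionalEquality
  using (_≡_; refl; sym; trans; cong; cong₂; subst; module ≡-Reasoning)
import Relation.Binary.PropositionalEquality.Properties as ≡
open import Relation.Nullary using (Dec; yes; no; ¬_; contradiction)

open import Algebra.Properties.CommutativeMonoid.Sum +-0-commutativeMonoid
  using (sum-syntax; sum-cong-≗; sum-replicate-zero; ∑-distrib-+; ∑-permute)

-- Nothing is assumed of s here, but the definitions have their usual
-- meaning only when (G , s) is a Coxeter system.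

module Generated {c ℓ i : Level} (G : Group c ℓ) {I : Set i}
                 (s : I → Group.Carrier G) where

  open Group G

  product : List I → Carrier
  product = foldr _∙_ ε ∘ map s

  HasLength : Carrier → ℕ → Set (i ⊔ ℓ)
  HasLength x k =
    (∃[ 𝐰 ] product 𝐰 ≈ x × length 𝐰 ≡ k) ×
    (∀ 𝐰 → product 𝐰 ≈ x → k ℕ.≤ length 𝐰)

  IsReducedWord : List I → Carrier → Set (i ⊔ ℓ)
  IsReducedWord 𝐰 w = product 𝐰 ≈ w × HasLength w (length 𝐰)

  IsReflection : Carrier → Set (c ⊔ ℓ ⊔ i)
  IsReflection t = ∃₂ λ g j → t ≈ g ∙ s j ∙ g ⁻¹

  -- The relation u ⟶ ut for t a reflection with ℓ(u) < ℓ(ut).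
  infix 4 _⟶_ _≤_

  _⟶_ : Carrier → Carrier → Set (c ⊔ ℓ ⊔ i)
  u ⟶ w =
    (∃[ t ] IsReflection t × w ≈ u ∙ t) ×
    (∃₂ λ k l → HasLength u k × HasLength w l × k ℕ.< l)

  -- Bruhat order: the reflexive-transitive closure of _⟶_, where
  -- reflexivity is with respect to the equality of G.
  data _≤_ : Carrier → Carrier → Set (c ⊔ ℓ ⊔ i) where
    ≤-reflexive : ∀ {u w} → u ≈ w → u ≤ w
    ≤-step      : ∀ {u x w} → u ⟶ x → x ≤ w → u ≤ w

  -- A subword of 𝐰 is encoded by the set of positions j at which
  -- v_j = s_{i_j}; at the remaining positions v_j = e.
  Subword : List I → Set
  Subword 𝐰 = Subset (length 𝐰)

  letter : I → Side → Carrier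
  letter j inside  = s j
  letter j outside = ε

  subproduct : ∀ 𝐰 → Subword 𝐰 → Carrier
  subproduct []      []      = ε
  subproduct (j ∷ 𝐰) (b ∷ 𝐯) = letter j b ∙ subproduct 𝐰 𝐯

  -- The argument x is the product of the letters already read, so that
  -- the successive values of x are the partial products 𝐯₍ⱼ₋₁₎.
  DistinguishedFrom : Carrier → ∀ 𝐰 → Subword 𝐰 → Set (c ⊔ ℓ ⊔ i)
  DistinguishedFrom x []      []      = Level.Lift _ ⊤
  DistinguishedFrom x (j ∷ 𝐰) (b ∷ 𝐯) =
    x ∙ letter j b ≤ x ∙ s j × DistinguishedFrom (x ∙ letter j b) 𝐰 𝐯

  Distinguished : ∀ 𝐰 → Subword 𝐰 → Set (c ⊔ ℓ ⊔ i)
  Distinguished = DistinguishedFrom ε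

  -- Elements are equal when the underlying subwords are, whatever the
  -- accompanying proofs; r counts the entries equal to e.
  𝒜 : ℕ → Carrier → List I → Setoid (c ⊔ ℓ ⊔ i) 0ℓ
  𝒜 r v 𝐰 = On.setoid (≡.setoid (Subword 𝐰)) carrier→subword
    where
    carrier→subword :
      (Σ[ 𝐯 ∈ Subword 𝐰 ]
         subproduct 𝐰 𝐯 ≈ v × Distinguished 𝐰 𝐯 × ∣ ∁ 𝐯 ∣ ≡ r) →
      Subword 𝐰
    carrier→subword = proj₁

-- The elements 1, …, n of ℤ.
window : ∀ {n} → Fin n → ℤ
window i = + suc (toℕ i)

record AffinePermutation (n : ℕ) : Set where
  field
    bijection : ℤ ↔ ℤ

  open Inverse bijection public
    using (to; from; strictlyInverseˡ; strictlyInverseʳ)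

  field
    periodic : ∀ x → to (x + + n) ≡ to x + + n
    balanced : ∑[ i < n ] (to (window i) - window i) ≡ 0ℤ

open AffinePermutation using (to; from)

infix 4 _≗ₐ_

_≗ₐ_ : ∀ {n} → AffinePermutation n → AffinePermutation n → Set
f ≗ₐ g = ∀ x → to f x ≡ to g x

module _ (n : ℕ) where

  Periodic : (ℤ → ℤ) → Set
  Periodic f = ∀ x → f (x + + n) ≡ f x + + n

  infix 4 _~_

  -- A record rather than a synonym for + n ∣ x - y, so that x and y can
  -- be inferred from the type.
  record _~_ (x y : ℤ) : Set where
    constructor mk~
    field n∣x-y : + n ∣ x - y

  displacement-cong : ∀ f → Periodic f → ∀ {x y} → x ~ y → f x - x ≡ f y - y
  displacement-cong f f-per {x} {y} (mk~ (divides q eq)) = begin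
    f x - x                       ≡⟨ cong (λ z → f z - z) x≡ ⟩
    f (y + q * + n) - (y + q * + n) ≡⟨ shift q y ⟩
    f y - y                       ∎
    where
    open ≡-Reasoning
    x≡ : x ≡ y + q * + n
    x≡ = trans (lem x y) (cong (_+_ y) eq)
      where
      lem : ∀ a b → a ≡ b + (a - b)
      lem = solve-∀
    step : ∀ z → f (z + + n) - (z + + n) ≡ f z - z
    step z = trans (cong (_- (z + + n)) (f-per z)) (lem (f z) z (+ n))
      where
      lem : ∀ a b c → (a + c) - (b + c) ≡ a - b
      lem = solve-∀
    δ : ℤ → ℤ
    δ z = f z - z
    shift⁺ : ∀ k z → δ (z + + k * + n) ≡ δ z
    shift⁺ zero    z = cong δ (lem z (+ n))
      where
      lem : ∀ a c → a + 0ℤ * c ≡ a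
      lem = solve-∀
    shift⁺ (suc k) z =
      trans (cong δ (lem z (+ k) (+ n))) (trans (step _) (shift⁺ k z))
      where
      lem : ∀ a k c → a + (1ℤ + k) * c ≡ (a + k * c) + c
      lem = solve-∀
    shift : ∀ q z → δ (z + q * + n) ≡ δ z
    shift (+ k)      z = shift⁺ k z
    shift (-[1+ k ]) z =
      trans (sym (shift⁺ (suc k) (z + -[1+ k ] * + n)))
            (cong δ (lem z (+ suc k) (+ n)))
      where
      lem : ∀ a k c → (a + - k * c) + k * c ≡ a
      lem = solve-∀

  ~-cong : ∀ f → Periodic f → ∀ {x y} → x ~ y → f x ~ f y
  ~-cong f f-per {x} {y} x~y@(mk~ d) = mk~ (subst (+ n ∣_) (sym eq) d)
    where
    lem₁ : ∀ a b x y → a - b ≡ (a - x) - (b - y) + (x - y)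
    lem₁ = solve-∀
    lem₂ : ∀ a b → a - a + b ≡ b
    lem₂ = solve-∀
    eq : f x - f y ≡ x - y
    eq = trans (lem₁ (f x) (f y) x y)
        (trans (cong (λ z → z - (f y - y) + (x - y)) (displacement-cong f f-per x~y))
               (lem₂ (f y - y) (x - y)))

  ~-trans : ∀ {x y z} → x ~ y → y ~ z → x ~ z
  ~-trans {x} {y} {z} (mk~ p) (mk~ q) = mk~ (subst (+ n ∣_) (lem x y z) (∣m∣n⇒∣m+n p q))
    where
    lem : ∀ a b c → (a - b) + (b - c) ≡ a - c
    lem = solve-∀

  ~-reflexive : ∀ {x y} → x ≡ y → x ~ y
  ~-reflexive {x} refl = mk~ (divides 0ℤ (+-inverseʳ x))

  ~-sym : ∀ {x y} → x ~ y → y ~ x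
  ~-sym {x} {y} (mk~ p) = mk~ (subst (+ n ∣_) (lem x y) (∣m⇒∣-m p))
    where
    lem : ∀ a b → - (a - b) ≡ b - a
    lem = solve-∀

  from-periodic : (b : ℤ ↔ ℤ) → Periodic (Inverse.to b) → Periodic (Inverse.from b)
  from-periodic b per y = begin
    B.from (y + + n)                ≡⟨ cong (λ z → B.from (z + + n)) (B.strictlyInverseˡ y) ⟨
    B.from (B.to (B.from y) + + n)  ≡⟨ cong B.from (per (B.from y)) ⟨
    B.from (B.to (B.from y + + n))  ≡⟨ B.strictlyInverseʳ _ ⟩
    B.from y + + n                  ∎
    where
    open ≡-Reasoning
    module B = Inverse b

  module _ .{{_ : NonZero n}} where

    residue : ℤ → Fin n
    residue x = fromℕ< (n%ℕd<d (x - 1ℤ) n)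

    window-residue : ∀ x → window (residue x) ~ x
    window-residue x = mk~ (divides (- ((x - 1ℤ) /ℕ n)) (begin
      + suc (toℕ (residue x)) - x        ≡⟨ cong (λ k → + suc k - x) (toℕ-fromℕ< (n%ℕd<d (x - 1ℤ) n)) ⟩
      + suc ((x - 1ℤ) %ℕ n) - x          ≡⟨ lem₁ (+ ((x - 1ℤ) %ℕ n)) x ⟩
      + ((x - 1ℤ) %ℕ n) - (x - 1ℤ)       ≡⟨ cong (λ z → + ((x - 1ℤ) %ℕ n) - z) (a≡a%ℕn+[a/ℕn]*n (x - 1ℤ) n) ⟩
      + ((x - 1ℤ) %ℕ n) - (+ ((x - 1ℤ) %ℕ n) + (x - 1ℤ) /ℕ n * + n)
                                         ≡⟨ lem₂ (+ ((x - 1ℤ) %ℕ n)) ((x - 1ℤ) /ℕ n) (+ n) ⟩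
      - ((x - 1ℤ) /ℕ n) * + n            ∎))
      where
      open ≡-Reasoning
      lem₁ : ∀ a x → (1ℤ + a) - x ≡ a - (x - 1ℤ)
      lem₁ = solve-∀
      lem₂ : ∀ a q c → a - (a + q * c) ≡ - q * c
      lem₂ = solve-∀

    <n∧~⇒≡ : ∀ {a b} → a ℕ.< n → b ℕ.< n → + a ~ + b → a ≡ b
    <n∧~⇒≡ {a} {b} a<n b<n (mk~ d) =
      +-injective (i-j≡0⇒i≡j (+ a) (+ b) (∣i∣≡0⇒i≡0 (small (∣⇒∣ᵤ d))))
      where
      bound : abs (+ a - + b) ℕ.< n
      bound = ℕ.≤-<-trans
        (subst (λ z → abs z ℕ.≤ a ℕ.⊔ b) (sym (m-n≡m⊖n a b)) (∣m⊝n∣≤m⊔n a b))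
        (ℕ.⊔-lub a<n b<n)
      small : n ℕ.∣ abs (+ a - + b) → abs (+ a - + b) ≡ 0
      small p with abs (+ a - + b) in e
      ... | zero  = refl
      ... | suc k = contradiction p (ℕ.>⇒∤ (subst (ℕ._< n) e bound))

    window-injective : ∀ {i j : Fin n} → window i ~ window j → i ≡ j
    window-injective {i} {j} (mk~ p) =
      toℕ-injective (<n∧~⇒≡ (toℕ<n i) (toℕ<n j)
        (mk~ (subst (+ n ∣_) (lem (+ toℕ i) (+ toℕ j)) p)))
      where
      lem : ∀ a b → (1ℤ + a) - (1ℤ + b) ≡ a - b
      lem = solve-∀

    induced : (b : ℤ ↔ ℤ) → Periodic (Inverse.to b) → Permutation′ n
    induced b per = permutation
      (residue ∘ B.to ∘ window) (residue ∘ B.from ∘ window)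
      (λ i → window-injective (~-trans (window-residue _)
               (~-trans (~-cong B.to per (window-residue _))
                        (~-reflexive (B.strictlyInverseˡ _)))))
      (λ i → window-injective (~-trans (window-residue _)
               (~-trans (~-cong B.from (from-periodic b per) (window-residue _))
                        (~-reflexive (B.strictlyInverseʳ _)))))
      where module B = Inverse b

    ∑-displacement-∘ : ∀ f → Periodic f → (b : ℤ ↔ ℤ) → Periodic (Inverse.to b) →
      let g = Inverse.to b in
      ∑[ i < n ] (f (g (window i)) - window i) ≡
      (∑[ i < n ] (f (window i) - window i)) + (∑[ i < n ] (g (window i) - window i))
    ∑-displacement-∘ f f-per b g-per = begin
      ∑[ i < n ] (f (g (window i)) - window i)
        ≡⟨ sum-cong-≗ {n} (λ i → lem (f (g (window i))) (g (window i)) (window i)) ⟩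
      ∑[ i < n ] ((f (g (window i)) - g (window i)) + (g (window i) - window i))
        ≡⟨ ∑-distrib-+ {n} (λ i → f (g (window i)) - g (window i)) (λ i → g (window i) - window i) ⟩
      (∑[ i < n ] (f (g (window i)) - g (window i))) + (∑[ i < n ] (g (window i) - window i))
        ≡⟨ cong (_+ (∑[ i < n ] (g (window i) - window i))) (sum-cong-≗ {n}
             (λ i → displacement-cong f f-per (~-sym (window-residue (g (window i)))))) ⟩
      (∑[ i < n ] (f (window (π ⟨$⟩ʳ i)) - window (π ⟨$⟩ʳ i))) + (∑[ i < n ] (g (window i) - window i))
        ≡⟨ cong (_+ (∑[ i < n ] (g (window i) - window i)))
             (∑-permute (λ i → f (window i) - window i) π) ⟨
      (∑[ i < n ] (f (window i) - window i)) + (∑[ i < n ] (g (window i) - window i))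
        ∎
      where
      open ≡-Reasoning
      g = Inverse.to b
      π = induced b g-per
      lem : ∀ a b c → a - c ≡ (a - b) + (b - c)
      lem = solve-∀

module _ (n : ℕ) .{{_ : NonZero n}} where

  private module A = AffinePermutation

  ∑-self : ∑[ i < n ] (window i - window i) ≡ 0ℤ
  ∑-self = trans (sum-cong-≗ {n} (λ i → +-inverseʳ (window i))) (sum-replicate-zero n)

  composeₐ : AffinePermutation n → AffinePermutation n → AffinePermutation n
  composeₐ f g = record
    { bijection = A.bijection f ↔-∘ A.bijection g
    ; periodic  = λ x → trans (cong (to f) (A.periodic g x)) (A.periodic f (to g x))
    ; balanced  = trans (∑-displacement-∘ n (to f) (A.periodic f) (A.bijection g) (A.periodic g))
                        (cong₂ _+_ (A.balanced f) (A.balanced g))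
    }

  idₐ : AffinePermutation n
  idₐ = record
    { bijection = ↔-id ℤ
    ; periodic  = λ _ → refl
    ; balanced  = ∑-self
    }

  inverseₐ : AffinePermutation n → AffinePermutation n
  inverseₐ f = record
    { bijection = ↔-sym (A.bijection f)
    ; periodic  = from-periodic n (A.bijection f) (A.periodic f)
    ; balanced  = begin
        ∑[ i < n ] (from f (window i) - window i)
          ≡⟨ +-identityʳ _ ⟨
        (∑[ i < n ] (from f (window i) - window i)) + 0ℤ
          ≡⟨ cong (_+_ (∑[ i < n ] (from f (window i) - window i))) (A.balanced f) ⟨
        (∑[ i < n ] (from f (window i) - window i)) + (∑[ i < n ] (to f (window i) - window i))
          ≡⟨ ∑-displacement-∘ n (from f) (from-periodic n (A.bijection f) (A.periodic f))
               (A.bijection f) (A.periodic f) ⟨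
        ∑[ i < n ] (from f (to f (window i)) - window i)
          ≡⟨ sum-cong-≗ {n} (λ i → cong (_- window i) (A.strictlyInverseʳ f (window i))) ⟩
        ∑[ i < n ] (window i - window i)
          ≡⟨ ∑-self ⟩
        0ℤ ∎
    }
    where open ≡-Reasoning

  affineGroup : Group 0ℓ 0ℓ
  affineGroup = record
    { Carrier = AffinePermutation n
    ; _≈_     = _≗ₐ_
    ; _∙_     = composeₐ
    ; ε       = idₐ
    ; _⁻¹     = inverseₐ
    ; isGroup = record
      { isMonoid = record
        { isSemigroup = record
          { isMagma = record
            { isEquivalence = record
              { refl  = λ _ → refl
              ; sym   = λ p x → sym (p x)
              ; trans = λ p q x → trans (p x) (q x)
              }
            ; ∙-cong = λ {f} {g} {h} {k} p q x → trans (p (to h x)) (cong (to g) (q x))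
            }
          ; assoc = λ _ _ _ _ → refl
          }
        ; identity = (λ _ _ → refl) , (λ _ _ → refl)
        }
      ; inverse = A.strictlyInverseʳ , A.strictlyInverseˡ
      ; ⁻¹-cong = λ {f} {g} p x → begin
          from f x                   ≡⟨ cong (from f) (A.strictlyInverseˡ g x) ⟨
          from f (to g (from g x))   ≡⟨ cong (from f) (p (from g x)) ⟨
          from f (to f (from g x))   ≡⟨ A.strictlyInverseʳ f (from g x) ⟩
          from g x                   ∎
      }
    }
    where open ≡-Reasoning

module SimpleGenerator (n : ℕ) (2≤n : 2 ℕ.≤ n) (a : ℤ) where

  swap-by : ∀ x → Dec (+ n ∣ x - a) → Dec (+ n ∣ x - (a + 1ℤ)) → ℤ
  swap-by x (yes _) _       = x + 1ℤ
  swap-by x (no _)  (yes _) = x - 1ℤ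
  swap-by x (no _)  (no _)  = x

  -- Exchanges a + mn and a + 1 + mn for all m.
  swap : ℤ → ℤ
  swap x = swap-by x (+ n ∣? x - a) (+ n ∣? x - (a + 1ℤ))

  n∤1 : ¬ (+ n ∣ 1ℤ)
  n∤1 p = ℕ.<⇒≢ 2≤n (sym (ℕ.∣1⇒≡1 (∣⇒∣ᵤ p)))

  disjoint : ∀ x → + n ∣ x - a → ¬ (+ n ∣ x - (a + 1ℤ))
  disjoint x p q = n∤1 (subst (+ n ∣_) (lem x a) (∣m∣n⇒∣m-n p q))
    where
    lem : ∀ x a → (x - a) - (x - (a + 1ℤ)) ≡ 1ℤ
    lem = solve-∀

  swap-lower : ∀ x → + n ∣ x - a → swap x ≡ x + 1ℤ
  swap-lower x p with + n ∣? x - a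
  ... | yes _ = refl
  ... | no ¬p = contradiction p ¬p

  swap-upper : ∀ x → + n ∣ x - (a + 1ℤ) → swap x ≡ x - 1ℤ
  swap-upper x q with + n ∣? x - a | + n ∣? x - (a + 1ℤ)
  ... | yes p | _     = contradiction q (disjoint x p)
  ... | no _  | yes _ = refl
  ... | no _  | no ¬q = contradiction q ¬q

  swap-fixed : ∀ x → ¬ (+ n ∣ x - a) → ¬ (+ n ∣ x - (a + 1ℤ)) → swap x ≡ x
  swap-fixed x ¬p ¬q with + n ∣? x - a | + n ∣? x - (a + 1ℤ)
  ... | yes p | _     = contradiction p ¬p
  ... | no _  | yes q = contradiction q ¬q
  ... | no _  | no _  = refl

  swap-involutive : ∀ x → swap (swap x) ≡ x
  swap-involutive x = go (+ n ∣? x - a) (+ n ∣? x - (a + 1ℤ))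
    where
    up : ∀ x a → x - a ≡ (x + 1ℤ) - (a + 1ℤ)
    up = solve-∀
    down : ∀ x a → x - (a + 1ℤ) ≡ (x - 1ℤ) - a
    down = solve-∀
    up-down : ∀ x → x + 1ℤ - 1ℤ ≡ x
    up-down = solve-∀
    down-up : ∀ x → x - 1ℤ + 1ℤ ≡ x
    down-up = solve-∀
    go : Dec (+ n ∣ x - a) → Dec (+ n ∣ x - (a + 1ℤ)) → swap (swap x) ≡ x
    go (yes p) _ = trans (cong swap (swap-lower _ p))
      (trans (swap-upper _ (subst (+ n ∣_) (up x a) p)) (up-down x))
    go (no _) (yes q) = trans (cong swap (swap-upper _ q))
      (trans (swap-lower _ (subst (+ n ∣_) (down x a) q)) (down-up x))
    go (no ¬p) (no ¬q) = trans (cong swap (swap-fixed _ ¬p ¬q)) (swap-fixed _ ¬p ¬q)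

  swap-periodic : ∀ x → swap (x + + n) ≡ swap x + + n
  swap-periodic x = go (+ n ∣? x - a) (+ n ∣? x - (a + 1ℤ))
    where
    up : ∀ x c → x + c + 1ℤ ≡ x + 1ℤ + c
    up = solve-∀
    down : ∀ x c → x + c - 1ℤ ≡ x - 1ℤ + c
    down = solve-∀
    move : ∀ x c b → (x - b) + c ≡ x + c - b
    move = solve-∀
    back : ∀ x c b → x + c - b - c ≡ x - b
    back = solve-∀
    add : ∀ b → + n ∣ x - b → + n ∣ x + + n - b
    add b p = subst (+ n ∣_) (move x (+ n) b) (∣m∣n⇒∣m+n p ∣-refl)
    del : ∀ b → + n ∣ x + + n - b → + n ∣ x - b
    del b p = subst (+ n ∣_) (back x (+ n) b) (∣m∣n⇒∣m-n p ∣-refl)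
    go : Dec (+ n ∣ x - a) → Dec (+ n ∣ x - (a + 1ℤ)) → swap (x + + n) ≡ swap x + + n
    go (yes p) _ = trans (swap-lower _ (add a p))
      (trans (up x (+ n)) (cong (_+ + n) (sym (swap-lower _ p))))
    go (no _) (yes q) = trans (swap-upper _ (add (a + 1ℤ) q))
      (trans (down x (+ n)) (cong (_+ + n) (sym (swap-upper _ q))))
    go (no ¬p) (no ¬q) = trans (swap-fixed _ (¬p ∘ del a) (¬q ∘ del (a + 1ℤ)))
      (cong (_+ + n) (sym (swap-fixed _ ¬p ¬q)))

  χ-by : ∀ x → Dec (+ n ∣ x - a) → ℤ
  χ-by _ (yes _) = 1ℤ
  χ-by _ (no _)  = 0ℤ

  -- The indicator function of the class of a modulo n; the displacement
  -- of swap is its backward difference, so its sum telescopes.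
  χ : ℤ → ℤ
  χ x = χ-by x (+ n ∣? x - a)

  χ-yes : ∀ x → + n ∣ x - a → χ x ≡ 1ℤ
  χ-yes x p with + n ∣? x - a
  ... | yes _ = refl
  ... | no ¬p = contradiction p ¬p

  χ-no : ∀ x → ¬ (+ n ∣ x - a) → χ x ≡ 0ℤ
  χ-no x ¬p with + n ∣? x - a
  ... | yes p = contradiction p ¬p
  ... | no _  = refl

  swap-displacement : ∀ x → swap (1ℤ + x) - (1ℤ + x) ≡ χ (1ℤ + x) - χ x
  swap-displacement x = go (+ n ∣? y - a) (+ n ∣? y - (a + 1ℤ))
    where
    y = 1ℤ + x
    e : ∀ x a → (1ℤ + x) - (a + 1ℤ) ≡ x - a
    e = solve-∀
    up : ∀ y → y + 1ℤ - y ≡ 1ℤ - 0ℤ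
    up = solve-∀
    down : ∀ y → y - 1ℤ - y ≡ 0ℤ - 1ℤ
    down = solve-∀
    upper : + n ∣ x - a → + n ∣ y - (a + 1ℤ)
    upper = subst (+ n ∣_) (sym (e x a))
    go : Dec (+ n ∣ y - a) → Dec (+ n ∣ y - (a + 1ℤ)) → swap y - y ≡ χ y - χ x
    go (yes p) _ = trans (cong (_- y) (swap-lower _ p))
      (trans (up y) (sym (cong₂ _-_ (χ-yes _ p) (χ-no _ (disjoint y p ∘ upper)))))
    go (no ¬p) (yes q) = trans (cong (_- y) (swap-upper _ q))
      (trans (down y) (sym (cong₂ _-_ (χ-no _ ¬p) (χ-yes _ (subst (+ n ∣_) (e x a) q)))))
    go (no ¬p) (no ¬q) = trans (cong (_- y) (swap-fixed _ ¬p ¬q))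
      (trans (+-inverseʳ y) (sym (cong₂ _-_ (χ-no _ ¬p) (χ-no _ (¬q ∘ upper)))))

  telescope : ∀ (h : ℤ → ℤ) m →
    ∑[ i < m ] (h (window i) - h (+ toℕ i)) ≡ h (+ m) - h 0ℤ
  telescope h zero    = sym (+-inverseʳ (h 0ℤ))
  telescope h (suc m) = trans
    (cong (_+_ (h 1ℤ - h 0ℤ)) (telescope (λ x → h (1ℤ + x)) m))
    (lem (h 1ℤ) (h 0ℤ) (h (+ suc m)))
    where
    lem : ∀ a b c → (a - b) + (c - a) ≡ c - b
    lem = solve-∀

  χ-n : χ (+ n) ≡ χ 0ℤ
  χ-n = go (+ n ∣? 0ℤ - a)
    where
    move : ∀ c b → (0ℤ - b) + c ≡ c - b
    move = solve-∀
    back : ∀ c b → c - b - c ≡ 0ℤ - b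
    back = solve-∀
    go : Dec (+ n ∣ 0ℤ - a) → χ (+ n) ≡ χ 0ℤ
    go (yes p) = trans (χ-yes _ (subst (+ n ∣_) (move (+ n) a) (∣m∣n⇒∣m+n p ∣-refl)))
                       (sym (χ-yes _ p))
    go (no ¬p) = trans
      (χ-no _ (λ q → ¬p (subst (+ n ∣_) (back (+ n) a) (∣m∣n⇒∣m-n q ∣-refl))))
      (sym (χ-no _ ¬p))

  generator : AffinePermutation n
  generator = record
    { bijection = mk↔ₛ′ swap swap swap-involutive swap-involutive
    ; periodic  = swap-periodic
    ; balanced  = trans (sum-cong-≗ {n} (λ i → swap-displacement (+ toℕ i)))
                 (trans (telescope χ n)
                 (trans (cong (_- χ 0ℤ) χ-n) (+-inverseʳ (χ 0ℤ))))
    }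

module AffineWeyl (n : ℕ) (3≤n : 3 ℕ.≤ n) where

  instance
    n≢0 : NonZero n
    n≢0 = >-nonZero (ℕ.≤-trans (s≤s z≤n) 3≤n)

  W : Group 0ℓ 0ℓ
  W = affineGroup n

  s : Fin n → AffinePermutation n
  s i = SimpleGenerator.generator n (ℕ.≤-trans (s≤s (s≤s z≤n)) 3≤n) (+ toℕ i)

  open Group W public using (Carrier; _≈_; _∙_; ε; _⁻¹)
  open Generated W s public

  next : Fin n → Fin n
  next i = suc (toℕ i) mod n

  data BraidMove : List (Fin n) → List (Fin n) → Set where
    braid : ∀ 𝐚 i 𝐛 → BraidMove (𝐚 ++ next i ∷ i ∷ next i ∷ 𝐛)
                                (𝐚 ++ i ∷ next i ∷ i ∷ 𝐛)

  BraidConnected : List (Fin n) → List (Fin n) → Set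
  BraidConnected = EqClosure BraidMove

-- Write x for the product of the letters already read.  Skipping s_j is allowed
-- exactly when x(j) < x(j+1): by the exchange property, chains of ascents have
-- minimal length, so a descent of x shortens it and an ascent lengthens it.
-- Being distinguished is thus a condition on the values of x, and for a braid
-- move on s_i, s_{i+1} it involves only the relative order of x(i), x(i+1) and
-- x(i+2).  Among the distinguished subwords of s_a s_b s_a, the product and the
-- number of skipped letters leave a single ambiguity, namely whether a lone s_a
-- is read first or last; whether a is an ascent of x settles it.  Matching
-- product and number of skips therefore gives the bijection.
module Submission where

open import Defs
open import Algebra.Bundles using (Group)
open import Data.Bool.Base using (Bool; true; false)
open import Data.Fin.Base using (Fin; toℕ)
open import Data.Fin.Properties using (toℕ-fromℕ<)
open import Data.Fin.Subset using (Subset; inside; outside; ∁; ∣_∣)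
open import Data.Integer.Base
  using (ℤ; +_; 1ℤ; _+_; _-_; _*_; -_; _<_)
  renaming (_≤_ to _≤ᶻ_)
import Data.Integer.Properties as ℤ
open import Data.Integer.Divisibility.Signed using (_∣_; divides; _∣?_; ∣⇒∣ᵤ)
open import Data.Integer.Tactic.RingSolver using (solve-∀)
open import Data.List.Base using (List; []; _∷_; _++_; _∷ʳ_; length; initLast; _∷ʳ′_)
open import Data.List.Properties using (length-++)
open import Data.Nat.Base as ℕ using (ℕ; zero; suc; s≤s; z≤n)
open import Data.Nat.DivMod using (_%_; _/_; m≡m%n+[m/n]*n; m%n<n)
import Data.Nat.Divisibility as ℕ
import Data.Nat.Properties as ℕ
open import Data.Product.Base using (∃-syntax; _×_; _,_; proj₁; proj₂)
open import Data.Sum.Base using (_⊎_; inj₁; inj₂)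
open import Data.Unit.Base using (⊤; tt)
open import Data.Vec.Base using ([]; _∷_)
open import Function.Base using (_∘_; id)
open import Function.Bundles using (Bijection; Equivalence; _⇔_; mk⇔)
open import Level using (0ℓ; lift)
open import Relation.Binary.Bundles using (Setoid)
open import Relation.Binary.Construct.Closure.ReflexiveTransitive
  using (_◅_) renaming (ε to done)
open import Relation.Binary.Construct.Closure.Symmetric using (fwd; bwd)
import Relation.Binary.Construct.Flip.EqAndOrd as Flip
open import Relation.Binary.Core using (Rel)
open import Relation.Binary.Definitions using (tri<; tri≈; tri>)
open import Relation.Binary.PropositionalEquality
  using (_≡_; _≢_; refl; sym; trans; cong; subst; subst₂; module ≡-Reasoning)
open import Relation.Binary.Structures using (IsStrictTotalOrder)
open import Relation.Nullary using (Dec; yes; no; does; ¬_; contradiction)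

open AffinePermutation using (to; from; periodic; bijection; strictlyInverseʳ)

module Affine (n : ℕ) (3≤n : 3 ℕ.≤ n) where

  open AffineWeyl n 3≤n using (s; next; n≢0)

  infix 4 _≈ₙ_
  _≈ₙ_ : ℤ → ℤ → Set
  _≈ₙ_ = _~_ n

  pos : Fin n → ℤ
  pos j = + toℕ j

  private
    module Gen (j : Fin n) = SimpleGenerator n (ℕ.≤-trans (s≤s (s≤s z≤n)) 3≤n) (pos j)

  ~-suc : ∀ {p q} → p ≈ₙ q → p + 1ℤ ≈ₙ q + 1ℤ
  ~-suc {p} {q} (mk~ d) = mk~ (subst (+ n ∣_) (lem p q) d)
    where
    lem : ∀ p q → p - q ≡ (p + 1ℤ) - (q + 1ℤ)
    lem = solve-∀

  ~-pred : ∀ {p q} → p ≈ₙ q + 1ℤ → p - 1ℤ ≈ₙ q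
  ~-pred {p} {q} (mk~ d) = mk~ (subst (+ n ∣_) (lem p q) d)
    where
    lem : ∀ p q → p - (q + 1ℤ) ≡ (p - 1ℤ) - q
    lem = solve-∀

  small⇒≁ : ∀ k {p q} → 0 ℕ.< k → k ℕ.< n → p - q ≡ + k → ¬ p ≈ₙ q
  small⇒≁ (suc k) _ k<n eq (mk~ d) = ℕ.>⇒∤ k<n (∣⇒∣ᵤ (subst (+ n ∣_) eq d))

  σ : Fin n → ℤ → ℤ
  σ j = to (s j)

  σ-lower : ∀ j {p} → p ≈ₙ pos j → σ j p ≡ p + 1ℤ
  σ-lower j (mk~ d) = Gen.swap-lower j _ d

  σ-upper : ∀ j {p} → p ≈ₙ pos j + 1ℤ → σ j p ≡ p - 1ℤ
  σ-upper j (mk~ d) = Gen.swap-upper j _ d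

  σ-fixed : ∀ j {p} → ¬ p ≈ₙ pos j → ¬ p ≈ₙ pos j + 1ℤ → σ j p ≡ p
  σ-fixed j p≁ p≁+1 = Gen.swap-fixed j _ (p≁ ∘ mk~) (p≁+1 ∘ mk~)

  σ-involutive : ∀ j p → σ j (σ j p) ≡ p
  σ-involutive j = Gen.swap-involutive j

  ~-dec : ∀ p q → Dec (p ≈ₙ q)
  ~-dec p q with + n ∣? p - q
  ... | yes d = yes (mk~ d)
  ... | no ¬d = no λ { (mk~ d) → ¬d d }

  to-~ : ∀ (x : AffinePermutation n) {p q} → p ≈ₙ q → to x p ≈ₙ to x q
  to-~ x = ~-cong n (to x) (periodic x)

  to-reflects-~ : ∀ (x : AffinePermutation n) {p q} → to x p ≈ₙ to x q → p ≈ₙ q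
  to-reflects-~ x {p} {q} r = subst₂ _≈ₙ_ (strictlyInverseʳ x p) (strictlyInverseʳ x q)
    (~-cong n (from x) (from-periodic n (bijection x) (periodic x)) r)

  to-injective : ∀ (x : AffinePermutation n) {p q} → to x p ≡ to x q → p ≡ q
  to-injective x {p} {q} eq =
    trans (sym (strictlyInverseʳ x p)) (trans (cong (from x) eq) (strictlyInverseʳ x q))

  translate : ∀ (x : AffinePermutation n) {p q} → p ≈ₙ q → to x p ≡ to x q + (p - q)
  translate x {p} {q} p~q = trans (lem₁ (to x p) p)
    (trans (cong (_+ p) (displacement-cong n (to x) (periodic x) p~q)) (lem₂ (to x q) p q))
    where
    lem₁ : ∀ a p → a ≡ (a - p) + p
    lem₁ = solve-∀
    lem₂ : ∀ b p q → (b - q) + p ≡ b + (p - q)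
    lem₂ = solve-∀

  i<i+1 : ∀ i → i < i + 1ℤ
  i<i+1 i = ℤ.suc[i]≤j⇒i<j (ℤ.≤-reflexive (ℤ.+-comm 1ℤ i))

  i<j⇒i+1≤j : ∀ {i j} → i < j → i + 1ℤ ≤ᶻ j
  i<j⇒i+1≤j {i} {j} i<j = subst (_≤ᶻ j) (ℤ.+-comm 1ℤ i) (ℤ.i<j⇒suc[i]≤j i<j)

  i<j⇒i≤j-1 : ∀ {i j} → i < j → i ≤ᶻ j - 1ℤ
  i<j⇒i≤j-1 {i} {j} i<j = subst (i ≤ᶻ_) (ℤ.+-comm (- 1ℤ) j) (ℤ.i<j⇒i≤pred[j] i<j)

  σ-≤ : ∀ k {p} → ¬ p ≈ₙ pos k → σ k p ≤ᶻ p
  σ-≤ k {p} p≁ with ~-dec p (pos k + 1ℤ)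
  ... | yes p~ = subst (_≤ᶻ p) (sym (σ-upper k p~)) (ℤ.i-j≤i p 1ℤ)
  ... | no p≁′ = ℤ.≤-reflexive (σ-fixed k p≁ p≁′)

  σ-≥ : ∀ k {p} → ¬ p ≈ₙ pos k + 1ℤ → p ≤ᶻ σ k p
  σ-≥ k {p} p≁ with ~-dec p (pos k)
  ... | yes p~ = subst (p ≤ᶻ_) (sym (σ-lower k p~)) (ℤ.<⇒≤ (i<i+1 p))
  ... | no p≁′ = ℤ.≤-reflexive (sym (σ-fixed k p≁′ p≁))

  σ-≥pred : ∀ k p → p - 1ℤ ≤ᶻ σ k p
  σ-≥pred k p with ~-dec p (pos k + 1ℤ)
  ... | yes p~ = ℤ.≤-reflexive (sym (σ-upper k p~))
  ... | no p≁  = ℤ.≤-trans (ℤ.i-j≤i p 1ℤ) (σ-≥ k p≁)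

  σ-reverses : ∀ k {p q} → p < q → σ k q < σ k p → p ≈ₙ pos k × q ≡ p + 1ℤ
  σ-reverses k {p} {q} p<q sq<sp with ~-dec p (pos k)
  ... | no p≁ = contradiction
    (ℤ.≤-trans (σ-≤ k p≁) (ℤ.≤-trans (i<j⇒i≤j-1 p<q) (σ-≥pred k q))) (ℤ.<⇒≱ sq<sp)
  ... | yes p~ with ~-dec q (pos k + 1ℤ)
  ...   | no q≁ = contradiction
    (subst (_≤ᶻ σ k q) (sym (σ-lower k p~)) (ℤ.≤-trans (i<j⇒i+1≤j p<q) (σ-≥ k q≁)))
    (ℤ.<⇒≱ sq<sp)
  ...   | yes q~ with ℤ.<-cmp q (p + 1ℤ)
  ...     | tri< q<p+1 _ _ = contradiction (i<j⇒i+1≤j p<q) (ℤ.<⇒≱ q<p+1)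
  ...     | tri≈ _ q≡p+1 _ = p~ , q≡p+1
  ...     | tri> _ _ p+1<q = contradiction (i<j⇒i≤j-1 p+1<q)
    (ℤ.<⇒≱ (subst₂ _<_ (σ-upper k q~) (σ-lower k p~) sq<sp))

  commute : ∀ (y : AffinePermutation n) j k →
            to y (pos j) ≈ₙ pos k → to y (pos j + 1ℤ) ≡ to y (pos j) + 1ℤ →
            ∀ z → to y (σ j z) ≡ σ k (to y z)
  commute y j k yj~k yj+1 z with ~-dec z (pos j)
  ... | yes z~ = begin
    to y (σ j z)                 ≡⟨ cong (to y) (σ-lower j z~) ⟩
    to y (z + 1ℤ)                     ≡⟨ translate y (~-suc z~) ⟩
    to y (pos j + 1ℤ) + (z + 1ℤ - (pos j + 1ℤ))
                                      ≡⟨ cong (_+ (z + 1ℤ - (pos j + 1ℤ))) yj+1 ⟩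
    to y (pos j) + 1ℤ + (z + 1ℤ - (pos j + 1ℤ))
                                      ≡⟨ lem (to y (pos j)) z (pos j) ⟩
    to y (pos j) + (z - pos j) + 1ℤ   ≡⟨ cong (_+ 1ℤ) (translate y z~) ⟨
    to y z + 1ℤ                       ≡⟨ σ-lower k (~-trans n (to-~ y z~) yj~k) ⟨
    σ k (to y z)                 ∎
    where
    open ≡-Reasoning
    lem : ∀ a z j → a + 1ℤ + (z + 1ℤ - (j + 1ℤ)) ≡ a + (z - j) + 1ℤ
    lem = solve-∀
  ... | no z≁ with ~-dec z (pos j + 1ℤ)
  ...   | yes z~ = begin
    to y (σ j z)                 ≡⟨ cong (to y) (σ-upper j z~) ⟩
    to y (z - 1ℤ)                     ≡⟨ translate y (~-pred z~) ⟩
    to y (pos j) + (z - 1ℤ - pos j)   ≡⟨ lem (to y (pos j)) z (pos j) ⟩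
    to y (pos j) + 1ℤ + (z - (pos j + 1ℤ)) - 1ℤ
                                      ≡⟨ cong (λ u → u + (z - (pos j + 1ℤ)) - 1ℤ) yj+1 ⟨
    to y (pos j + 1ℤ) + (z - (pos j + 1ℤ)) - 1ℤ
                                      ≡⟨ cong (_- 1ℤ) (translate y z~) ⟨
    to y z - 1ℤ                       ≡⟨ σ-upper k yz~ ⟨
    σ k (to y z)                 ∎
    where
    open ≡-Reasoning
    lem : ∀ a z j → a + (z - 1ℤ - j) ≡ a + 1ℤ + (z - (j + 1ℤ)) - 1ℤ
    lem = solve-∀
    yz~ : to y z ≈ₙ pos k + 1ℤ
    yz~ = ~-trans n (to-~ y z~) (~-trans n (~-reflexive n yj+1) (~-suc yj~k))
  ...   | no z≁′ = trans (cong (to y) (σ-fixed j z≁ z≁′))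
    (sym (σ-fixed k
      (λ yz~ → z≁ (to-reflects-~ y (~-trans n yz~ (~-sym n yj~k))))
      (λ yz~ → z≁′ (to-reflects-~ y (~-trans n yz~
        (~-trans n (~-suc (~-sym n yj~k)) (~-reflexive n (sym yj+1))))))))

  Ascent : (ℤ → ℤ) → Fin n → Set
  Ascent ξ j = ξ (pos j) < ξ (pos j + 1ℤ)

  Descent : (ℤ → ℤ) → Fin n → Set
  Descent ξ j = ξ (pos j + 1ℤ) < ξ (pos j)

  ascent? : ∀ ξ j → Dec (Ascent ξ j)
  ascent? ξ j = ξ (pos j) ℤ.<? ξ (pos j + 1ℤ)

  ascent⊎descent : ∀ (x : AffinePermutation n) j → Ascent (to x) j ⊎ Descent (to x) j
  ascent⊎descent x j with ℤ.<-cmp (to x (pos j)) (to x (pos j + 1ℤ))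
  ... | tri< asc _ _  = inj₁ asc
  ... | tri≈ _ eq _   = contradiction (to-injective x eq) (ℤ.<⇒≢ (i<i+1 (pos j)))
  ... | tri> _ _ desc = inj₂ desc

  σ-at-lower : ∀ j → σ j (pos j) ≡ pos j + 1ℤ
  σ-at-lower j = σ-lower j (~-reflexive n refl)

  σ-at-upper : ∀ j → σ j (pos j + 1ℤ) ≡ pos j
  σ-at-upper j = trans (σ-upper j (~-reflexive n refl)) (lem (pos j))
    where
    lem : ∀ p → p + 1ℤ - 1ℤ ≡ p
    lem = solve-∀

  -- P, Q, R are the three positions permuted by σ a and σ b, listed in the
  -- order that makes σ a exchange the first two.  Taking the flipped order ≺
  -- along with the reversed list exchanges the roles of a and b.
  record BraidPair (a b : Fin n) : Set₁ where
    field
      P Q R : ℤ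
      _≺_   : Rel ℤ 0ℓ
      isStrictTotalOrder : IsStrictTotalOrder _≡_ _≺_
      aP : σ a P ≡ Q
      aQ : σ a Q ≡ P
      aR : σ a R ≡ R
      bP : σ b P ≡ P
      bQ : σ b Q ≡ R
      bR : σ b R ≡ Q
      ascent-a : ∀ (x : AffinePermutation n) → Ascent (to x) a ⇔ (to x P ≺ to x Q)
      ascent-b : ∀ (x : AffinePermutation n) → Ascent (to x) b ⇔ (to x Q ≺ to x R)
      Q≢R   : Q ≢ R
      P≢Q   : P ≢ Q
      braid-relation : ∀ z → σ a (σ b (σ a z)) ≡ σ b (σ a (σ b z))

    open IsStrictTotalOrder isStrictTotalOrder public
      using (compare; asym) renaming (trans to ≺-trans)

    ¬ascent-b : ∀ (x : AffinePermutation n) → ¬ Ascent (to x) b → to x R ≺ to x Q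
    ¬ascent-b x ¬asc with compare (to x Q) (to x R)
    ... | tri< q≺r _ _ = contradiction (Equivalence.from (ascent-b x) q≺r) ¬asc
    ... | tri≈ _ eq _  = contradiction (to-injective x eq) Q≢R
    ... | tri> _ _ r≺q = r≺q

  flip : ∀ {a b} → BraidPair a b → BraidPair b a
  flip pair = record
    { P = R ; Q = Q ; R = P ; _≺_ = λ p q → q ≺ p
    ; isStrictTotalOrder = Flip.isStrictTotalOrder isStrictTotalOrder
    ; aP = bR ; aQ = bQ ; aR = bP ; bP = aR ; bQ = aQ ; bR = aP
    ; ascent-a = ascent-b ; ascent-b = ascent-a
    ; Q≢R = P≢Q ∘ sym ; P≢Q = Q≢R ∘ sym
    ; braid-relation = λ z → sym (braid-relation z)
    }
    where open BraidPair pair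

  pos-next : ∀ i → pos (next i) ≈ₙ pos i + 1ℤ
  pos-next i = ~-sym n (mk~ (divides (+ (m / n)) (begin
    + toℕ i + 1ℤ - + toℕ (next i)             ≡⟨ cong (λ z → + toℕ i + 1ℤ - + z) (toℕ-fromℕ< (m%n<n m n)) ⟩
    + toℕ i + 1ℤ - + (m % n)                  ≡⟨ cong (_- + (m % n)) (ℤ.+-comm (+ toℕ i) 1ℤ) ⟩
    + m - + (m % n)                           ≡⟨ cong (λ z → + z - + (m % n)) (m≡m%n+[m/n]*n m n) ⟩
    + (m % n ℕ.+ m / n ℕ.* n) - + (m % n)     ≡⟨ cong (λ z → + (m % n) + z - + (m % n)) (ℤ.pos-* (m / n) n) ⟩
    + (m % n) + + (m / n) * + n - + (m % n)   ≡⟨ lem (+ (m % n)) (+ (m / n) * + n) ⟩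
    + (m / n) * + n                           ∎)))
    where
    open ≡-Reasoning
    m = suc (toℕ i)
    lem : ∀ a b → a + b - a ≡ b
    lem = solve-∀

  ascent-shift : ∀ (x : AffinePermutation n) j {p} → p ≈ₙ pos j →
                 Ascent (to x) j ⇔ (to x p < to x (p + 1ℤ))
  ascent-shift x j {p} p~j = mk⇔
    (λ asc → subst₂ _<_ (sym (translate x p~j)) (sym eq) (ℤ.+-monoˡ-< (p - pos j) asc))
    (λ asc → subst₂ _<_ (back (to x (pos j)) (p - pos j)) (back (to x (pos j + 1ℤ)) (p - pos j))
      (ℤ.+-monoˡ-< (- (p - pos j)) (subst₂ _<_ (translate x p~j) eq asc)))
    where
    lem : ∀ p q → p + 1ℤ - (q + 1ℤ) ≡ p - q
    lem = solve-∀
    back : ∀ a b → a + b + - b ≡ a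
    back = solve-∀
    eq : to x (p + 1ℤ) ≡ to x (pos j + 1ℤ) + (p - pos j)
    eq = trans (translate x (~-suc p~j)) (cong (_+_ (to x (pos j + 1ℤ))) (lem p (pos j)))

  adjacent : ∀ i → BraidPair i (next i)
  adjacent i = record
    { P = p ; Q = q ; R = r ; _≺_ = _<_
    ; isStrictTotalOrder = ℤ.<-isStrictTotalOrder
    ; aP = σ-at-lower i
    ; aQ = σ-at-upper i
    ; aR = ir
    ; bP = jp
    ; bQ = jq
    ; bR = trans (σ-upper j (~-suc q~j)) (lem₁ q)
    ; ascent-a = λ _ → mk⇔ id id
    ; ascent-b = λ x → ascent-shift x j q~j
    ; Q≢R = ℤ.<⇒≢ (i<i+1 q)
    ; P≢Q = ℤ.<⇒≢ (i<i+1 p)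
    ; braid-relation = commute (composeₐ n (s i) (s j)) i j
        (~-trans n (~-reflexive n σσp≡q) q~j)
        (trans (cong (σ i) jq) (trans ir (cong (_+ 1ℤ) (sym σσp≡q))))
    }
    where
    j = next i
    p = pos i
    q = p + 1ℤ
    r = q + 1ℤ
    q~j : q ≈ₙ pos j
    q~j = ~-sym n (pos-next i)
    lem₁ : ∀ q → q + 1ℤ - 1ℤ ≡ q
    lem₁ = solve-∀
    1<n : 1 ℕ.< n
    1<n = ℕ.≤-trans (s≤s (s≤s z≤n)) 3≤n
    diff₁ : ∀ p → p + 1ℤ - p ≡ 1ℤ
    diff₁ = solve-∀
    diff₂ : ∀ p → p + 1ℤ + 1ℤ - p ≡ 1ℤ + 1ℤ
    diff₂ = solve-∀
    ir : σ i r ≡ r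
    ir = σ-fixed i (small⇒≁ 2 (s≤s z≤n) 3≤n (diff₂ p)) (small⇒≁ 1 (s≤s z≤n) 1<n (diff₁ q))
    jp : σ j p ≡ p
    jp = σ-fixed j
      (λ p~j → small⇒≁ 1 (s≤s z≤n) 1<n (diff₁ p) (~-trans n q~j (~-sym n p~j)))
      (λ p~j+1 → small⇒≁ 2 (s≤s z≤n) 3≤n (diff₂ p)
        (~-trans n (~-suc q~j) (~-sym n p~j+1)))
    jq : σ j q ≡ r
    jq = σ-lower j q~j
    σσp≡q : σ i (σ j p) ≡ q
    σσp≡q = trans (cong (σ i) jp) (σ-at-lower i)

-- The development takes place in an abstract group, because comparing products
-- of concrete affine permutations would make the conversion checker compare the
-- proofs inside them.
record FaithfulAction (n : ℕ) (3≤n : 3 ℕ.≤ n) (G : Group 0ℓ 0ℓ)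
                      (s : Fin n → Group.Carrier G) : Set where
  open Group G using (Carrier; _≈_; _∙_; ε)
  field
    perm           : Carrier → AffinePermutation n
    perm-cong      : ∀ {x y} → x ≈ y → perm x ≗ₐ perm y
    perm-injective : ∀ {x y} → perm x ≗ₐ perm y → x ≈ y
    perm-ε         : ∀ z → to (perm ε) z ≡ z
    perm-∙         : ∀ x y z → to (perm (x ∙ y)) z ≡ to (perm x) (to (perm y) z)
    perm-s         : ∀ j z → to (perm (s j)) z ≡ Affine.σ n 3≤n j z

module Words (n : ℕ) (3≤n : 3 ℕ.≤ n) (G : Group 0ℓ 0ℓ) (s : Fin n → Group.Carrier G)
             (action : FaithfulAction n 3≤n G s) where

  open Affine n 3≤n
  open FaithfulAction action
  open AffineWeyl n 3≤n using (next; BraidMove; braid; BraidConnected)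
  open Generated G s renaming (_≤_ to _≤ᴮ_)
  open Group G
    using (Carrier; _≈_; _∙_; ε; assoc; identityˡ; identityʳ; inverseʳ; ∙-congˡ; ∙-congʳ)
    renaming (refl to ≈-refl; sym to ≈-sym; trans to ≈-trans)

  ⟦_⟧ : Carrier → ℤ → ℤ
  ⟦ x ⟧ = to (perm x)

  ⟦∙s⟧ : ∀ x j z → ⟦ x ∙ s j ⟧ z ≡ ⟦ x ⟧ (σ j z)
  ⟦∙s⟧ x j z = trans (perm-∙ x (s j) z) (cong ⟦ x ⟧ (perm-s j z))

  ⟦s∙⟧ : ∀ j x z → ⟦ s j ∙ x ⟧ z ≡ σ j (⟦ x ⟧ z)
  ⟦s∙⟧ j x z = trans (perm-∙ (s j) x z) (perm-s j (⟦ x ⟧ z))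

  cancelʳ : ∀ x j → x ∙ s j ∙ s j ≈ x
  cancelʳ x j = perm-injective λ z →
    trans (⟦∙s⟧ (x ∙ s j) j z) (trans (⟦∙s⟧ x j (σ j z)) (cong ⟦ x ⟧ (σ-involutive j z)))

  cancelˡ : ∀ j x → s j ∙ (s j ∙ x) ≈ x
  cancelˡ j x = perm-injective λ z →
    trans (⟦s∙⟧ j (s j ∙ x) z) (trans (cong (σ j) (⟦s∙⟧ j x z)) (σ-involutive j (⟦ x ⟧ z)))

  ascent-resp : ∀ {x y} j → x ≈ y → Ascent ⟦ x ⟧ j → Ascent ⟦ y ⟧ j
  ascent-resp j x≈y = subst₂ _<_ (perm-cong x≈y _) (perm-cong x≈y _)

  descent-resp : ∀ {x y} j → x ≈ y → Descent ⟦ x ⟧ j → Descent ⟦ y ⟧ j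
  descent-resp j x≈y = subst₂ _<_ (perm-cong x≈y _) (perm-cong x≈y _)

  ascent⇒descent : ∀ x j → Ascent ⟦ x ⟧ j → Descent ⟦ x ∙ s j ⟧ j
  ascent⇒descent x j = subst₂ _<_
    (sym (trans (⟦∙s⟧ x j _) (cong ⟦ x ⟧ (σ-at-upper j))))
    (sym (trans (⟦∙s⟧ x j _) (cong ⟦ x ⟧ (σ-at-lower j))))

  exchange : ∀ 𝐰 j → Descent ⟦ product 𝐰 ⟧ j →
             ∃[ 𝐰′ ] product 𝐰′ ≈ product 𝐰 ∙ s j × length 𝐰 ≡ suc (length 𝐰′)
  exchange []      j desc =
    contradiction (subst₂ _<_ (perm-ε _) (perm-ε _) desc) (ℤ.<-asym (i<i+1 (pos j)))
  exchange (k ∷ 𝐰) j desc with ascent⊎descent (perm (product 𝐰)) j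
  ... | inj₂ desc′ =
    let 𝐰′ , eq , len = exchange 𝐰 j desc′
    in  k ∷ 𝐰′ , ≈-trans (∙-congˡ eq) (≈-sym (assoc _ _ _)) , cong suc len
  ... | inj₁ asc = 𝐰 , ≈-sym (≈-trans (assoc _ _ _) (≈-trans (∙-congˡ ys≈sy) (cancelˡ k y))) , refl
    where
    y = product 𝐰
    reversed = σ-reverses k asc (subst₂ _<_ (⟦s∙⟧ k y _) (⟦s∙⟧ k y _) desc)
    ys≈sy : y ∙ s j ≈ s k ∙ y
    ys≈sy = perm-injective λ z → trans (⟦∙s⟧ y j z)
      (trans (commute (perm y) j k (proj₁ reversed) (proj₂ reversed) z) (sym (⟦s∙⟧ k y z)))

  product-∷ʳ : ∀ 𝐰 j → product (𝐰 ∷ʳ j) ≈ product 𝐰 ∙ s j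
  product-∷ʳ []      j = ≈-trans (identityʳ (s j)) (≈-sym (identityˡ (s j)))
  product-∷ʳ (k ∷ 𝐰) j = ≈-trans (∙-congˡ (product-∷ʳ 𝐰 j)) (≈-sym (assoc _ _ _))

  length-∷ʳ : ∀ (𝐰 : List (Fin n)) j → length (𝐰 ∷ʳ j) ≡ suc (length 𝐰)
  length-∷ʳ 𝐰 j = trans (length-++ 𝐰) (ℕ.+-comm (length 𝐰) 1)

  data AscentChain (x : Carrier) : ℕ → Set where
    base : x ≈ ε → AscentChain x 0
    step : ∀ {y k} j → AscentChain y k → Ascent ⟦ y ⟧ j → x ≈ y ∙ s j → AscentChain x (suc k)

  chain-word : ∀ {x k} → AscentChain x k → ∃[ 𝐰 ] product 𝐰 ≈ x × length 𝐰 ≡ k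
  chain-word (base x≈ε) = [] , ≈-sym x≈ε , refl
  chain-word (step j c _ x≈ys) =
    let 𝐰 , eq , len = chain-word c
    in  𝐰 ∷ʳ j
      , ≈-trans (product-∷ʳ 𝐰 j) (≈-trans (∙-congʳ eq) (≈-sym x≈ys))
      , trans (length-∷ʳ 𝐰 j) (cong suc len)

  chain-minimal : ∀ {x k} → AscentChain x k → ∀ 𝐰 → product 𝐰 ≈ x → k ℕ.≤ length 𝐰
  chain-minimal (base _) 𝐰 eq = z≤n
  chain-minimal (step {y} {k} j c asc x≈ys) 𝐰 eq =
    let 𝐰≈ys = ≈-trans eq x≈ys
        𝐰′ , eq′ , len = exchange 𝐰 j (descent-resp j (≈-sym 𝐰≈ys) (ascent⇒descent y j asc))
    in  subst (suc k ℕ.≤_) (sym len) (s≤s (chain-minimal c 𝐰′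
          (≈-trans eq′ (≈-trans (∙-congʳ 𝐰≈ys) (cancelʳ y j)))))

  chain-length : ∀ {x k} → AscentChain x k → HasLength x k
  chain-length c = chain-word c , chain-minimal c

  -- Recursion on a bound for the length, because the exchange property yields
  -- a word that need not be a subterm.
  chain : ∀ N 𝐰 {x} → length 𝐰 ℕ.≤ N → product 𝐰 ≈ x → ∃[ k ] AscentChain x k
  chain N 𝐰 len≤ eq with initLast 𝐰
  chain N       _ len≤ eq | [] = 0 , base (≈-sym eq)
  chain zero    _ len≤ eq | 𝐰 ∷ʳ′ j with () ← subst (ℕ._≤ 0) (length-∷ʳ 𝐰 j) len≤
  chain (suc N) _ {x} len≤ eq | 𝐰 ∷ʳ′ j =
    extend (chain N 𝐰 len𝐰≤N ≈-refl) (ascent⊎descent (perm (product 𝐰)) j)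
    where
    x≈𝐰s : x ≈ product 𝐰 ∙ s j
    x≈𝐰s = ≈-trans (≈-sym eq) (product-∷ʳ 𝐰 j)
    len𝐰≤N : length 𝐰 ℕ.≤ N
    len𝐰≤N = ℕ.s≤s⁻¹ (subst (ℕ._≤ suc N) (length-∷ʳ 𝐰 j) len≤)
    extend : ∃[ k ] AscentChain (product 𝐰) k →
             Ascent ⟦ product 𝐰 ⟧ j ⊎ Descent ⟦ product 𝐰 ⟧ j → ∃[ k ] AscentChain x k
    extend (k , c) (inj₁ asc)  = suc k , step j c asc x≈𝐰s
    extend _       (inj₂ desc) =
      let 𝐰′ , eq′ , len = exchange 𝐰 j desc
      in  chain N 𝐰′ (ℕ.≤-trans (ℕ.n≤1+n _) (subst (ℕ._≤ N) len len𝐰≤N))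
            (≈-trans eq′ (≈-sym x≈𝐰s))

  HasLength-resp : ∀ {x y k} → x ≈ y → HasLength x k → HasLength y k
  HasLength-resp x≈y ((𝐰 , eq , len) , min) =
    (𝐰 , ≈-trans eq x≈y , len) , λ 𝐮 eq′ → min 𝐮 (≈-trans eq′ (≈-sym x≈y))

  HasLength-unique : ∀ {x k l} → HasLength x k → HasLength x l → k ≡ l
  HasLength-unique ((𝐰 , eq , refl) , min) ((𝐮 , eq′ , refl) , min′) =
    ℕ.≤-antisym (min 𝐮 eq′) (min′ 𝐰 eq)

  Longer : Carrier → Carrier → Set
  Longer x y = ∃[ k ] ∃[ l ] HasLength x k × HasLength y l × k ℕ.< l

  ≤⇒≈⊎longer : ∀ {x y} → x ≤ᴮ y → x ≈ y ⊎ Longer x y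
  ≤⇒≈⊎longer (≤-reflexive x≈y) = inj₁ x≈y
  ≤⇒≈⊎longer (≤-step (_ , k , l , Lx , Lz , k<l) z≤y) with ≤⇒≈⊎longer z≤y
  ... | inj₁ z≈y = inj₂ (k , l , Lx , HasLength-resp z≈y Lz , k<l)
  ... | inj₂ (l′ , m , Lz′ , Ly , l′<m) = inj₂ (k , m , Lx , Ly ,
    ℕ.<-trans k<l (subst (ℕ._< m) (HasLength-unique Lz′ Lz) l′<m))

  ≤⇒ascent : ∀ x j → x ∙ ε ≤ᴮ x ∙ s j → Ascent ⟦ x ⟧ j
  ≤⇒ascent x j x≤xs with ascent⊎descent (perm x) j
  ... | inj₁ asc  = asc
  ... | inj₂ desc with ≤⇒≈⊎longer x≤xs
  ...   | inj₁ x≈xs = contradiction (to-injective (perm x) (begin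
    ⟦ x ⟧ (pos j)           ≡⟨ perm-cong (≈-trans (≈-sym (identityʳ x)) x≈xs) (pos j) ⟩
    ⟦ x ∙ s j ⟧ (pos j)     ≡⟨ ⟦∙s⟧ x j (pos j) ⟩
    ⟦ x ⟧ (σ j (pos j))     ≡⟨ cong ⟦ x ⟧ (σ-at-lower j) ⟩
    ⟦ x ⟧ (pos j + 1ℤ)      ∎)) (ℤ.<⇒≢ (i<i+1 (pos j)))
    where open ≡-Reasoning
  ...   | inj₂ (_ , _ , ((𝐰 , eq , refl) , _) , (_ , min) , k<l) =
    let 𝐰≈x = ≈-trans eq (identityʳ x)
        𝐰′ , eq′ , len = exchange 𝐰 j (descent-resp j (≈-sym 𝐰≈x) desc)
        l≤ = min 𝐰′ (≈-trans eq′ (∙-congʳ 𝐰≈x))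
    in  contradiction (ℕ.<-≤-trans k<l l≤) (ℕ.≤⇒≯ (subst (length 𝐰′ ℕ.≤_) (sym len) (ℕ.n≤1+n _)))

  s-isReflection : ∀ j → IsReflection (s j)
  s-isReflection j = s j , j ,
    ≈-sym (≈-trans (assoc _ _ _) (≈-trans (∙-congˡ (inverseʳ (s j))) (identityʳ (s j))))

  ascent⇒≤ : ∀ {x} 𝐩 j → product 𝐩 ≈ x → Ascent ⟦ x ⟧ j → x ∙ ε ≤ᴮ x ∙ s j
  ascent⇒≤ {x} 𝐩 j eq asc =
    let k , c = chain (length 𝐩) 𝐩 ℕ.≤-refl eq
    in  ≤-step
          ((s j , s-isReflection j , ∙-congʳ (≈-sym (identityʳ x))) ,
           k , suc k , HasLength-resp (≈-sym (identityʳ x)) (chain-length c) ,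
           chain-length (step j c asc ≈-refl) , ℕ.n<1+n k)
          (≤-reflexive ≈-refl)

  -- Unlike DistinguishedFrom and subproduct, the next two definitions do not
  -- multiply by ε at the skipped letters.
  Ascending : Carrier → ∀ 𝐰 → Subword 𝐰 → Set
  Ascending x []      []            = ⊤
  Ascending x (j ∷ 𝐰) (inside ∷ 𝐯)  = Ascending (x ∙ s j) 𝐰 𝐯
  Ascending x (j ∷ 𝐰) (outside ∷ 𝐯) = Ascent ⟦ x ⟧ j × Ascending x 𝐰 𝐯

  value : ∀ 𝐰 → Subword 𝐰 → Carrier
  value []      []            = ε
  value (j ∷ 𝐰) (inside ∷ 𝐯)  = s j ∙ value 𝐰 𝐯
  value (j ∷ 𝐰) (outside ∷ 𝐯) = value 𝐰 𝐯

  subproduct≈value : ∀ 𝐰 𝐯 → subproduct 𝐰 𝐯 ≈ value 𝐰 𝐯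
  subproduct≈value []      []            = ≈-refl
  subproduct≈value (j ∷ 𝐰) (inside ∷ 𝐯)  = ∙-congˡ (subproduct≈value 𝐰 𝐯)
  subproduct≈value (j ∷ 𝐰) (outside ∷ 𝐯) = ≈-trans (identityˡ _) (subproduct≈value 𝐰 𝐯)

  ascending-resp : ∀ {x y} 𝐰 𝐯 → x ≈ y → Ascending x 𝐰 𝐯 → Ascending y 𝐰 𝐯
  ascending-resp []      []            x≈y _       = tt
  ascending-resp (j ∷ 𝐰) (inside ∷ 𝐯)  x≈y d       = ascending-resp 𝐰 𝐯 (∙-congʳ x≈y) d
  ascending-resp (j ∷ 𝐰) (outside ∷ 𝐯) x≈y (a , d) = ascent-resp j x≈y a , ascending-resp 𝐰 𝐯 x≈y d

  distinguished⇒ascending : ∀ x 𝐰 𝐯 → DistinguishedFrom x 𝐰 𝐯 → Ascending x 𝐰 𝐯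
  distinguished⇒ascending x []      []            _       = tt
  distinguished⇒ascending x (j ∷ 𝐰) (inside ∷ 𝐯)  (_ , d) = distinguished⇒ascending (x ∙ s j) 𝐰 𝐯 d
  distinguished⇒ascending x (j ∷ 𝐰) (outside ∷ 𝐯) (p , d) =
    ≤⇒ascent x j p , ascending-resp 𝐰 𝐯 (identityʳ x) (distinguished⇒ascending (x ∙ ε) 𝐰 𝐯 d)

  ascending⇒distinguished : ∀ x 𝐩 𝐰 𝐯 → product 𝐩 ≈ x → Ascending x 𝐰 𝐯 → DistinguishedFrom x 𝐰 𝐯
  ascending⇒distinguished x 𝐩 []      []            eq _       = lift tt
  ascending⇒distinguished x 𝐩 (j ∷ 𝐰) (inside ∷ 𝐯)  eq d       =
    ≤-reflexive ≈-refl ,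
    ascending⇒distinguished (x ∙ s j) (𝐩 ∷ʳ j) 𝐰 𝐯 (≈-trans (product-∷ʳ 𝐩 j) (∙-congʳ eq)) d
  ascending⇒distinguished x 𝐩 (j ∷ 𝐰) (outside ∷ 𝐯) eq (a , d) =
    ascent⇒≤ 𝐩 j eq a ,
    ascending⇒distinguished (x ∙ ε) 𝐩 𝐰 𝐯 (≈-trans eq (≈-sym (identityʳ x)))
      (ascending-resp 𝐰 𝐯 (≈-sym (identityʳ x)) d)

  Transports : ∀ 𝐰 𝐮 → (Carrier → Subword 𝐰 → Subword 𝐮) → (Carrier → Subword 𝐮 → Subword 𝐰) → Set
  Transports 𝐰 𝐮 f g = ∀ x 𝐯 → Ascending x 𝐰 𝐯 →
    Ascending x 𝐮 (f x 𝐯) ×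
    value 𝐮 (f x 𝐯) ≈ value 𝐰 𝐯 ×
    ∣ ∁ (f x 𝐯) ∣ ≡ ∣ ∁ 𝐯 ∣ ×
    g x (f x 𝐯) ≡ 𝐯

  record Correspondence (𝐰 𝐮 : List (Fin n)) : Set where
    field
      f     : Carrier → Subword 𝐰 → Subword 𝐮
      g     : Carrier → Subword 𝐮 → Subword 𝐰
      f-transports : Transports 𝐰 𝐮 f g
      g-transports : Transports 𝐮 𝐰 g f

  correspondence-refl : ∀ {𝐰} → Correspondence 𝐰 𝐰
  correspondence-refl = record
    { f = λ _ 𝐯 → 𝐯 ; g = λ _ 𝐯 → 𝐯
    ; f-transports = λ _ _ d → d , ≈-refl , refl , refl
    ; g-transports = λ _ _ d → d , ≈-refl , refl , refl
    }

  correspondence-sym : ∀ {𝐰 𝐮} → Correspondence 𝐰 𝐮 → Correspondence 𝐮 𝐰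
  correspondence-sym c = record
    { f = g ; g = f ; f-transports = g-transports ; g-transports = f-transports }
    where open Correspondence c

  correspondence-trans : ∀ {𝐰 𝐮 𝐭} → Correspondence 𝐰 𝐮 → Correspondence 𝐮 𝐭 → Correspondence 𝐰 𝐭
  correspondence-trans {𝐰} {𝐮} {𝐭} c c′ = record
    { f = λ x → C′.f x ∘ C.f x ; g = λ x → C.g x ∘ C′.g x
    ; f-transports = compose {𝐰} {𝐮} {𝐭} C.f C.g C′.f C′.g C.f-transports C′.f-transports
    ; g-transports = compose {𝐭} {𝐮} {𝐰} C′.g C′.f C.g C.f C′.g-transports C.g-transports
    }
    where
    module C = Correspondence c
    module C′ = Correspondence c′
    compose : ∀ {𝐰 𝐮 𝐭} f g f′ g′ → Transports 𝐰 𝐮 f g → Transports 𝐮 𝐭 f′ g′ →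
              Transports 𝐰 𝐭 (λ x → f′ x ∘ f x) (λ x → g x ∘ g′ x)
    compose f g f′ g′ T T′ x 𝐯 d =
      let d₁ , eq₁ , r₁ , inv₁ = T x 𝐯 d
          d₂ , eq₂ , r₂ , inv₂ = T′ x (f x 𝐯) d₁
      in  d₂ , ≈-trans eq₂ eq₁ , trans r₂ r₁ , trans (cong (g x) inv₂) inv₁

  read : Carrier → Fin n → Bool → Carrier
  read x j inside  = x ∙ s j
  read x j outside = x

  lift-∷ : ∀ {𝐰 𝐮} j → (Carrier → Subword 𝐰 → Subword 𝐮) →
           Carrier → Subword (j ∷ 𝐰) → Subword (j ∷ 𝐮)
  lift-∷ j f x (b ∷ 𝐯) = b ∷ f (read x j b) 𝐯

  transports-∷ : ∀ {𝐰 𝐮} f g j → Transports 𝐰 𝐮 f g →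
                 Transports (j ∷ 𝐰) (j ∷ 𝐮) (lift-∷ {𝐰} {𝐮} j f) (lift-∷ {𝐮} {𝐰} j g)
  transports-∷ f g j T x (inside ∷ 𝐯) d =
    let d′ , eq , r , inv = T (x ∙ s j) 𝐯 d
    in  d′ , ∙-congˡ eq , r , cong (inside ∷_) inv
  transports-∷ f g j T x (outside ∷ 𝐯) (a , d) =
    let d′ , eq , r , inv = T x 𝐯 d
    in  (a , d′) , eq , cong suc r , cong (outside ∷_) inv

  correspondence-++ : ∀ 𝐚 {𝐰 𝐮} → Correspondence 𝐰 𝐮 → Correspondence (𝐚 ++ 𝐰) (𝐚 ++ 𝐮)
  correspondence-++ []      c = c
  correspondence-++ (j ∷ 𝐚) {𝐰} {𝐮} c = record
    { f = lift-∷ {𝐚 ++ 𝐰} {𝐚 ++ 𝐮} j f ; g = lift-∷ {𝐚 ++ 𝐮} {𝐚 ++ 𝐰} j g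
    ; f-transports = transports-∷ {𝐚 ++ 𝐰} {𝐚 ++ 𝐮} f g j f-transports
    ; g-transports = transports-∷ {𝐚 ++ 𝐮} {𝐚 ++ 𝐰} g f j g-transports
    }
    where open Correspondence (correspondence-++ 𝐚 {𝐰} {𝐮} c)

  -- On s_a s_b s_a; the flag says whether b is an ascent of the prefix.
  braid-subword : ∀ {m} → Bool → Subset (3 ℕ.+ m) → Subset (3 ℕ.+ m)
  braid-subword _     (inside  ∷ inside  ∷ outside ∷ 𝐯) = outside ∷ inside  ∷ inside  ∷ 𝐯
  braid-subword _     (outside ∷ inside  ∷ inside  ∷ 𝐯) = inside  ∷ inside  ∷ outside ∷ 𝐯
  braid-subword true  (outside ∷ inside  ∷ outside ∷ 𝐯) = outside ∷ outside ∷ inside  ∷ 𝐯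
  braid-subword false (outside ∷ inside  ∷ outside ∷ 𝐯) = inside  ∷ outside ∷ outside ∷ 𝐯
  braid-subword _     (inside  ∷ outside ∷ outside ∷ 𝐯) = outside ∷ inside  ∷ outside ∷ 𝐯
  braid-subword _     (outside ∷ outside ∷ inside  ∷ 𝐯) = outside ∷ inside  ∷ outside ∷ 𝐯
  braid-subword _     (b₁      ∷ b₂      ∷ b₃      ∷ 𝐯) = b₁ ∷ b₂ ∷ b₃ ∷ 𝐯

  module _ {a b} (pair : BraidPair a b) where
    open BraidPair pair

    ascent-∙b-a : ∀ x → Ascent ⟦ x ∙ s b ⟧ a ⇔ (⟦ x ⟧ P ≺ ⟦ x ⟧ R)
    ascent-∙b-a x = subst₂ (λ p q → Ascent ⟦ x ∙ s b ⟧ a ⇔ (p ≺ q))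
      (trans (⟦∙s⟧ x b P) (cong ⟦ x ⟧ bP)) (trans (⟦∙s⟧ x b Q) (cong ⟦ x ⟧ bQ))
      (ascent-a (perm (x ∙ s b)))

    ascent-∙b-b : ∀ x → Ascent ⟦ x ∙ s b ⟧ b ⇔ (⟦ x ⟧ R ≺ ⟦ x ⟧ Q)
    ascent-∙b-b x = subst₂ (λ p q → Ascent ⟦ x ∙ s b ⟧ b ⇔ (p ≺ q))
      (trans (⟦∙s⟧ x b Q) (cong ⟦ x ⟧ bQ)) (trans (⟦∙s⟧ x b R) (cong ⟦ x ⟧ bR))
      (ascent-b (perm (x ∙ s b)))

    ascent-∙b∙a-b : ∀ x → Ascent ⟦ x ∙ s b ∙ s a ⟧ b ⇔ (⟦ x ⟧ P ≺ ⟦ x ⟧ Q)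
    ascent-∙b∙a-b x = subst₂ (λ p q → Ascent ⟦ x ∙ s b ∙ s a ⟧ b ⇔ (p ≺ q))
      (trans (⟦∙s∙s⟧ Q) (cong ⟦ x ⟧ (trans (cong (σ b) aQ) bP)))
      (trans (⟦∙s∙s⟧ R) (cong ⟦ x ⟧ (trans (cong (σ b) aR) bR)))
      (ascent-b (perm (x ∙ s b ∙ s a)))
      where
      ⟦∙s∙s⟧ : ∀ z → ⟦ x ∙ s b ∙ s a ⟧ z ≡ ⟦ x ⟧ (σ b (σ a z))
      ⟦∙s∙s⟧ z = trans (⟦∙s⟧ (x ∙ s b) a z) (⟦∙s⟧ x b (σ a z))

  braid-≈ : ∀ {a b} → BraidPair a b → s a ∙ (s b ∙ s a) ≈ s b ∙ (s a ∙ s b)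
  braid-≈ {a} {b} pair = perm-injective λ z →
    trans (expand a b z) (trans (BraidPair.braid-relation pair z) (sym (expand b a z)))
    where
    expand : ∀ a b z → ⟦ s a ∙ (s b ∙ s a) ⟧ z ≡ σ a (σ b (σ a z))
    expand a b z = trans (⟦s∙⟧ a (s b ∙ s a) z)
      (cong (σ a) (trans (⟦s∙⟧ b (s a) z) (cong (σ b) (perm-s a z))))

  braid-≈ˡ : ∀ {a b} → BraidPair a b → ∀ x → x ∙ s a ∙ s b ∙ s a ≈ x ∙ s b ∙ s a ∙ s b
  braid-≈ˡ pair x = ≈-trans (regroup _ _) (≈-trans (∙-congˡ (braid-≈ pair)) (≈-sym (regroup _ _)))
    where
    regroup : ∀ y z → x ∙ y ∙ z ∙ y ≈ x ∙ (y ∙ (z ∙ y))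
    regroup y z = ≈-trans (assoc _ _ _) (assoc _ _ _)

  braid-≈ʳ : ∀ {a b} → BraidPair a b → ∀ x → s a ∙ (s b ∙ (s a ∙ x)) ≈ s b ∙ (s a ∙ (s b ∙ x))
  braid-≈ʳ pair x = ≈-trans (≈-sym (regroup _ _)) (≈-trans (∙-congʳ (braid-≈ pair)) (regroup _ _))
    where
    regroup : ∀ y z → y ∙ (z ∙ y) ∙ x ≈ y ∙ (z ∙ (y ∙ x))
    regroup y z = ≈-trans (assoc _ _ _) (∙-congˡ (assoc _ _ _))

  module _ {a b} (pair : BraidPair a b) (𝐛 : List (Fin n)) where
    open BraidPair pair
    open Equivalence using () renaming (to to ⇒; from to ⇐)

    braid-transports : Transports (a ∷ b ∷ a ∷ 𝐛) (b ∷ a ∷ b ∷ 𝐛)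
      (λ x → braid-subword (does (ascent? ⟦ x ⟧ b))) (λ x → braid-subword (does (ascent? ⟦ x ⟧ a)))
    braid-transports x (inside ∷ inside ∷ inside ∷ 𝐯) d =
      ascending-resp 𝐛 𝐯 (braid-≈ˡ pair x) d , braid-≈ʳ (flip pair) (value 𝐛 𝐯) , refl , refl
    braid-transports x (inside ∷ inside ∷ outside ∷ 𝐯) (p , d) =
      (⇐ (ascent-b (perm x)) (⇒ (ascent-∙b∙a-b (flip pair) x) p) , d) , ≈-refl , refl , refl
    braid-transports x (outside ∷ inside ∷ inside ∷ 𝐯) (p , d) =
      (⇐ (ascent-∙b∙a-b pair x) (⇒ (ascent-a (perm x)) p) , d) , ≈-refl , refl , refl
    braid-transports x (inside ∷ outside ∷ inside ∷ 𝐯) (p , d) =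
      (⇐ (ascent-∙b-a pair x) (⇒ (ascent-∙b-a (flip pair) x) p) ,
       ascending-resp 𝐛 𝐯 (≈-trans (cancelʳ x a) (≈-sym (cancelʳ x b))) d) ,
      ≈-trans (cancelˡ b _) (≈-sym (cancelˡ a _)) , refl , refl
    braid-transports x (outside ∷ outside ∷ outside ∷ 𝐯) (p , q , _ , d) =
      (q , p , q , d) , ≈-refl , refl , refl
    braid-transports x (outside ∷ inside ∷ outside ∷ 𝐯) (p , q , d) with ascent? ⟦ x ⟧ b
    ... | yes asc = (asc , p , d) , ≈-refl , refl , refl
    ... | no ¬asc =
      (q , ⇐ (ascent-∙b-b pair x) (¬ascent-b (perm x) ¬asc) , d) , ≈-refl , refl , refl
    braid-transports x (inside ∷ outside ∷ outside ∷ 𝐯) (p , q , d) =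
      (⇐ (ascent-b (perm x))
         (≺-trans (⇒ (ascent-∙b-b (flip pair) x) q) (⇒ (ascent-∙b-a (flip pair) x) p)) ,
       p , d) ,
      ≈-refl , refl , restored
      where
      restored : braid-subword (does (ascent? ⟦ x ⟧ a)) (outside ∷ inside ∷ outside ∷ 𝐯) ≡
                 inside ∷ outside ∷ outside ∷ 𝐯
      restored with ascent? ⟦ x ⟧ a
      ... | yes asc =
        contradiction (⇒ (ascent-∙b-b (flip pair) x) q) (asym (⇒ (ascent-a (perm x)) asc))
      ... | no _    = refl
    braid-transports x (outside ∷ outside ∷ inside ∷ 𝐯) (p , q , d) =
      (q ,
       ⇐ (ascent-∙b-a (flip pair) x)
         (≺-trans (⇒ (ascent-a (perm x)) p) (⇒ (ascent-b (perm x)) q)) ,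
       d) ,
      ≈-refl , refl , restored
      where
      restored : braid-subword (does (ascent? ⟦ x ⟧ a)) (outside ∷ inside ∷ outside ∷ 𝐯) ≡
                 outside ∷ outside ∷ inside ∷ 𝐯
      restored with ascent? ⟦ x ⟧ a
      ... | yes _   = refl
      ... | no ¬asc = contradiction p ¬asc

  braid-correspondence : ∀ {𝐰 𝐮} → BraidMove 𝐰 𝐮 → Correspondence 𝐰 𝐮
  braid-correspondence (braid 𝐚 i 𝐛) =
    correspondence-++ 𝐚 {next i ∷ i ∷ next i ∷ 𝐛} {i ∷ next i ∷ i ∷ 𝐛} record
      { f = λ x → braid-subword (does (ascent? ⟦ x ⟧ i))
      ; g = λ x → braid-subword (does (ascent? ⟦ x ⟧ (next i)))
      ; f-transports = braid-transports (flip (adjacent i)) 𝐛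
      ; g-transports = braid-transports (adjacent i) 𝐛
      }

  correspondence : ∀ {𝐰 𝐮} → BraidConnected 𝐰 𝐮 → Correspondence 𝐰 𝐮
  correspondence done        = correspondence-refl
  correspondence (fwd m ◅ c) = correspondence-trans (braid-correspondence m) (correspondence c)
  correspondence (bwd m ◅ c) =
    correspondence-trans (correspondence-sym (braid-correspondence m)) (correspondence c)

  correspondence⇒bijection : ∀ {𝐰 𝐮} → Correspondence 𝐰 𝐮 → ∀ r v → Bijection (𝒜 r v 𝐰) (𝒜 r v 𝐮)
  correspondence⇒bijection {𝐰} {𝐮} c r v = record
    { to        = move {𝐰} {𝐮} f g f-transports
    ; cong      = cong (f ε)
    ; bijective =
        (λ {x} {y} eq → trans (sym (inverse {𝐰} {𝐮} f g f-transports x))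
                       (trans (cong (g ε) eq) (inverse {𝐰} {𝐮} f g f-transports y))) ,
        (λ y → move {𝐮} {𝐰} g f g-transports y , λ eq →
                 trans (cong (f ε) eq) (inverse {𝐮} {𝐰} g f g-transports y))
    }
    where
    open Correspondence c
    move : ∀ {𝐰 𝐮} f g → Transports 𝐰 𝐮 f g → Setoid.Carrier (𝒜 r v 𝐰) → Setoid.Carrier (𝒜 r v 𝐮)
    move {𝐰} {𝐮} f g T (𝐯 , eq , d , count) =
      let d′ , eq′ , count′ , _ = T ε 𝐯 (distinguished⇒ascending ε 𝐰 𝐯 d)
      in  f ε 𝐯
        , ≈-trans (subproduct≈value 𝐮 (f ε 𝐯))
            (≈-trans eq′ (≈-trans (≈-sym (subproduct≈value 𝐰 𝐯)) eq))
        , ascending⇒distinguished ε [] 𝐮 (f ε 𝐯) ≈-refl d′ , trans count′ count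
    inverse : ∀ {𝐰 𝐮} f g → Transports 𝐰 𝐮 f g → ∀ (y : Setoid.Carrier (𝒜 r v 𝐰)) →
              g ε (f ε (proj₁ y)) ≡ proj₁ y
    inverse {𝐰} f g T (𝐯 , _ , d , _) =
      proj₂ (proj₂ (proj₂ (T ε 𝐯 (distinguished⇒ascending ε 𝐰 𝐯 d))))

tautological : ∀ n 3≤n → FaithfulAction n 3≤n (AffineWeyl.W n 3≤n) (AffineWeyl.s n 3≤n)
tautological n 3≤n = record
  { perm           = id
  ; perm-cong      = id
  ; perm-injective = id
  ; perm-ε         = λ _ → refl
  ; perm-∙         = λ _ _ _ → refl
  ; perm-s         = λ _ _ → refl
  }

lemma3p26 : (n : ℕ) (3≤n : 3 ℕ.≤ n) → let open AffineWeyl n 3≤n in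
    (w : Carrier) (𝐰 𝐮 : List (Fin n)) →
    IsReducedWord 𝐰 w → IsReducedWord 𝐮 w → BraidConnected 𝐰 𝐮 →
    (v : Carrier) → v ≤ w → (r : ℕ) →
    Bijection (𝒜 r v 𝐰) (𝒜 r v 𝐮)
lemma3p26 n 3≤n w 𝐰 𝐮 _ _ connected v _ r =
  correspondence⇒bijection {𝐰} {𝐮} (correspondence connected) r v
  where open Words n 3≤n (AffineWeyl.W n 3≤n) (AffineWeyl.s n 3≤n) (tautological n 3≤n)
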